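{- For every positive integer $k$ there exists a CIS graph $G_k$ such that $|V(G_k)| > k\cdot \alpha(G_k)\cdot \omega(G_k)$.
   Context: All graphs are finite and simple. A graph is CIS if every inclusion-maximal clique intersects every inclusion-maximal stable set. $\alpha(G)$ is the maximum size of a stable set and $\omega(G)$ the maximum size of a clique in $G$. -}

module Defs where

open import Data.Nat using (ℕ; _≤_)
open import Data.Fin using (Fin)
open import Data.Fin.Subset using (Subset; _∈_; _⊆_; ∣_∣)
open import Data.Product using (Σ; _×_)
open import Relation.Binary.PropositionalEquality using (_≡_)
open import Relation.Nullary using (¬_)

record Graph (n : ℕ) : Set₁ where
  field
    Adj     : Fin n → Fin n → Set
    sym     : ∀ {u v} → Adj u v → Adj v u
    irrefl  : ∀ {u} → ¬ Adj u u
open Graph public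

module _ {n : ℕ} (G : Graph n) where

  IsClique : Subset n → Set
  IsClique S = ∀ {u v} → u ∈ S → v ∈ S → ¬ (u ≡ v) → Adj G u v

  IsStable : Subset n → Set
  IsStable S = ∀ {u v} → u ∈ S → v ∈ S → ¬ Adj G u v

  IsMaximalClique : Subset n → Set
  IsMaximalClique S = IsClique S × (∀ T → IsClique T → S ⊆ T → T ⊆ S)

  IsMaximalStable : Subset n → Set
  IsMaximalStable S = IsStable S × (∀ T → IsStable T → S ⊆ T → T ⊆ S)

  IsCIS : Set
  IsCIS = ∀ C S → IsMaximalClique C → IsMaximalStable S → Σ (Fin n) (λ v → v ∈ C × v ∈ S)

  IsAlpha : ℕ → Set
  IsAlpha a = Σ (Subset n) (λ S → IsStable S × ∣ S ∣ ≡ a) × (∀ S → IsStable S → ∣ S ∣ ≤ a)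

  IsOmega : ℕ → Set
  IsOmega w = Σ (Subset n) (λ S → IsClique S × ∣ S ∣ ≡ w) × (∀ S → IsClique S → ∣ S ∣ ≤ w)

{-# OPTIONS --safe #-}

-- For a graph B, let Φ B be the lexicographic product C₅[B] together with five new
-- vertices v₀, …, v₄, where vᵢ is joined to the copies of B numbered i and i + 1 (mod 5).
-- As C₅ is triangle-free, every clique lies in {vᵢ} ∪ copy i ∪ copy (i + 1) for some i, so
-- every maximal clique contains some vᵢ. A maximal stable set that misses vᵢ meets copy i
-- or copy i + 1, and inside that copy both sets are maximal; hence Φ preserves CIS.
-- Moreover |V|, α, ω become 5|V| + 5, 2α + 1 (if α ≥ 2), 2ω + 1, so each application
-- multiplies |V| / (α ω) asymptotically by 5/4, and iterating Φ makes it unbounded.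
module Submission where

open import Defs
open import Data.Bool using (true; false)
open import Data.Empty using (⊥-elim) renaming (⊥ to Absurd)
open import Data.Fin using (Fin; zero; suc; combine; remQuot)
open import Data.Fin.Patterns using (0F; 1F; 2F; 3F; 4F)
open import Data.Fin.Properties using (_≟_; any?; all?; remQuot-combine; combine-surjective)
open import Data.Fin.Subset using (Subset; inside; outside; _∈_; _∉_; _∪_; ⁅_⁆; ⊥; ⊤; ∣_∣; Nonempty; Empty)
open import Data.Fin.Subset.Properties using (_∈?_; nonempty?; Empty-unique; drop-there; ∉⊥; ∣⊥∣≡0; ∣p∣≤n; x∈⁅x⁆; x∈⁅y⁆⇒x≡y; x∈p∪q⁻; p⊆p∪q; q⊆p∪q)
open import Data.Nat using (ℕ; zero; suc; _+_; _*_; _^_; _≤_; _>_; z≤n; s≤s; >-nonZero)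
open import Data.Nat.Properties
  using (+-identityʳ; +-monoʳ-≤; +-mono-≤; *-assoc; *-monoʳ-≤; *-monoʳ-<; *-mono-<; *-cancelˡ-≤;
         n<1+n; n≤1+n; m≤m+n; m≤n+m; ≤-refl; ≤-trans; ≤-reflexive; module ≤-Reasoning)
open import Data.Nat.Tactic.RingSolver using (solve-∀)
open import Data.Product using (Σ; ∃; _×_; _,_; proj₁)
open import Data.Sum using (_⊎_; inj₁; inj₂)
open import Data.Vec using (Vec; []; _∷_; _++_; concat; group; here; there; lookup; map; sum; tail)
open import Data.Vec.Properties using (lookup-concat; lookup⇒[]=; []=⇒lookup)
open import Function using (_∘_)
open import Relation.Binary.PropositionalEquality using (_≡_; _≢_; refl; trans; cong; cong₂; subst; subst₂) renaming (sym to ≡-sym)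
open import Relation.Nullary using (¬_; Dec; yes; no; contradiction; ¬?)
open import Relation.Nullary.Decidable using (_⊎-dec_; _→-dec_; from-yes)

-- Subsets

private
  variable
    m n : ℕ

∣++∣ : (p : Subset m) (q : Subset n) → ∣ p ++ q ∣ ≡ ∣ p ∣ + ∣ q ∣
∣++∣ []          q = refl
∣++∣ (true ∷ p)  q = cong suc (∣++∣ p q)
∣++∣ (false ∷ p) q = ∣++∣ p q

∣concat∣ : (ps : Vec (Subset n) m) → ∣ concat ps ∣ ≡ sum (map ∣_∣ ps)
∣concat∣ []       = refl
∣concat∣ (p ∷ ps) = trans (∣++∣ p (concat ps)) (cong (∣ p ∣ +_) (∣concat∣ ps))

module _ (ps : Vec (Subset n) m) {i : Fin m} {x : Fin n} where

  ∈-concat⁺ : x ∈ lookup ps i → combine i x ∈ concat ps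
  ∈-concat⁺ h = lookup⇒[]= _ _ (trans (lookup-concat ps i x) ([]=⇒lookup h))

  ∈-concat⁻ : combine i x ∈ concat ps → x ∈ lookup ps i
  ∈-concat⁻ h = lookup⇒[]= _ _ (trans (≡-sym (lookup-concat ps i x)) ([]=⇒lookup h))

∈-tail⁺ : {p : Subset (suc n)} {x : Fin n} → suc x ∈ p → x ∈ tail p
∈-tail⁺ {p = _ ∷ _} = drop-there

∈-tail⁻ : {p : Subset (suc n)} {x : Fin n} → x ∈ tail p → suc x ∈ p
∈-tail⁻ {p = _ ∷ _} = there

∣p∣≤1+∣tail∣ : (p : Subset (suc n)) → ∣ p ∣ ≤ 1 + ∣ tail p ∣
∣p∣≤1+∣tail∣ (true ∷ p)  = ≤-refl
∣p∣≤1+∣tail∣ (false ∷ p) = n≤1+n _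

∣p∣≤∣tail∣ : (p : Subset (suc n)) → zero ∉ p → ∣ p ∣ ≤ ∣ tail p ∣
∣p∣≤∣tail∣ (true ∷ p)  0∉p = contradiction here 0∉p
∣p∣≤∣tail∣ (false ∷ p) 0∉p = ≤-refl

Empty⇒∣p∣≤0 : (p : Subset n) → Empty p → ∣ p ∣ ≤ 0
Empty⇒∣p∣≤0 {n} p e rewrite Empty-unique e = ≤-reflexive (∣⊥∣≡0 n)

-- Maximality tested vertex by vertex

module _ (G : Graph n) where

  CliqueSaturated : Subset n → Set
  CliqueSaturated C = ∀ w → (∀ u → u ∈ C → u ≢ w → Adj G u w) → w ∈ C

  StableSaturated : Subset n → Set
  StableSaturated S = ∀ w → (∀ u → u ∈ S → ¬ Adj G u w) → w ∈ S

  -- Adding `w` to `C` leaves a clique, so maximality already puts `w` in `C`.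
  maximal⇒cliqueSaturated : ∀ {C} → IsMaximalClique G C → CliqueSaturated C
  maximal⇒cliqueSaturated {C} (clq , max) w h =
    max (C ∪ ⁅ w ⁆) clq′ (p⊆p∪q ⁅ w ⁆) (q⊆p∪q C ⁅ w ⁆ (x∈⁅x⁆ w))
    where
    clq′ : IsClique G (C ∪ ⁅ w ⁆)
    clq′ {u} {v} p q u≢v with x∈p∪q⁻ C ⁅ w ⁆ p | x∈p∪q⁻ C ⁅ w ⁆ q
    ... | inj₁ u∈C | inj₁ v∈C = clq u∈C v∈C u≢v
    ... | inj₁ u∈C | inj₂ v∈w rewrite x∈⁅y⁆⇒x≡y w v∈w = h u u∈C u≢v
    ... | inj₂ u∈w | inj₁ v∈C rewrite x∈⁅y⁆⇒x≡y w u∈w = sym G (h v v∈C (u≢v ∘ ≡-sym))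
    ... | inj₂ u∈w | inj₂ v∈w =
      contradiction (trans (x∈⁅y⁆⇒x≡y w u∈w) (≡-sym (x∈⁅y⁆⇒x≡y w v∈w))) u≢v

  maximal⇒stableSaturated : ∀ {S} → IsMaximalStable G S → StableSaturated S
  maximal⇒stableSaturated {S} (stb , max) w h =
    max (S ∪ ⁅ w ⁆) stb′ (p⊆p∪q ⁅ w ⁆) (q⊆p∪q S ⁅ w ⁆ (x∈⁅x⁆ w))
    where
    stb′ : IsStable G (S ∪ ⁅ w ⁆)
    stb′ {u} {v} p q with x∈p∪q⁻ S ⁅ w ⁆ p | x∈p∪q⁻ S ⁅ w ⁆ q
    ... | inj₁ u∈S | inj₁ v∈S = stb u∈S v∈S
    ... | inj₁ u∈S | inj₂ v∈w rewrite x∈⁅y⁆⇒x≡y w v∈w = h u u∈S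
    ... | inj₂ u∈w | inj₁ v∈S rewrite x∈⁅y⁆⇒x≡y w u∈w = h v v∈S ∘ sym G
    ... | inj₂ u∈w | inj₂ v∈w rewrite x∈⁅y⁆⇒x≡y w u∈w | x∈⁅y⁆⇒x≡y w v∈w = irrefl G

  cliqueSaturated⇒maximal : ∀ {C} → IsClique G C → CliqueSaturated C → IsMaximalClique G C
  cliqueSaturated⇒maximal clq sat =
    clq , λ T clqT C⊆T {w} w∈T → sat w λ u u∈C → clqT (C⊆T u∈C) w∈T

  stableSaturated⇒maximal : ∀ {S} → IsStable G S → StableSaturated S → IsMaximalStable G S
  stableSaturated⇒maximal stb sat =
    stb , λ T stbT S⊆T {w} w∈T → sat w λ u u∈S → stbT (S⊆T u∈S) w∈T

-- The pentagon

next : Fin 5 → Fin 5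
next 0F = 1F
next 1F = 2F
next 2F = 3F
next 3F = 4F
next 4F = 0F

next⁵ : ∀ i → next (next (next (next (next i)))) ≡ i
next⁵ 0F = refl
next⁵ 1F = refl
next⁵ 2F = refl
next⁵ 3F = refl
next⁵ 4F = refl

-- Here `i` names the pentagon edge from `i` to `next i`, and `j` is one of its ends. The same
-- relation decides which copies the new vertex vᵢ is joined to.
On : Fin 5 → Fin 5 → Set
On i j = j ≡ i ⊎ j ≡ next i

Cyc : Fin 5 → Fin 5 → Set
Cyc i j = j ≡ next i ⊎ i ≡ next j

Near : Fin 5 → Fin 5 → Set
Near i j = i ≡ j ⊎ Cyc i j

on? : ∀ i j → Dec (On i j)
on? i j = (j ≟ i) ⊎-dec (j ≟ next i)

near? : ∀ i j → Dec (Near i j)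
near? i j = (i ≟ j) ⊎-dec ((j ≟ next i) ⊎-dec (i ≟ next j))

cyc-sym : ∀ {i j} → Cyc i j → Cyc j i
cyc-sym (inj₁ e) = inj₂ e
cyc-sym (inj₂ e) = inj₁ e

cyc-irrefl : ∀ i → ¬ Cyc i i
cyc-irrefl = from-yes (all? λ i → ¬? ((i ≟ next i) ⊎-dec (i ≟ next i)))

on⇒near : ∀ i {j l} → On i j → On i l → Near j l
on⇒near i (inj₁ refl) (inj₁ refl) = inj₁ refl
on⇒near i (inj₁ refl) (inj₂ refl) = inj₂ (inj₁ refl)
on⇒near i (inj₂ refl) (inj₁ refl) = inj₂ (inj₂ refl)
on⇒near i (inj₂ refl) (inj₂ refl) = inj₁ refl

-- This is the triangle-freeness of C₅: a further vertex adjacent to both ends of an edge would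
-- close a triangle. All 25 pairs are decided by evaluation.
near-edge : ∀ l m → Near l m → Near (next l) m → On l m
near-edge = from-yes (all? λ l → all? λ m → near? l m →-dec near? (next l) m →-dec on? l m)

-- Four steps forward are one step back: the closed neighbourhood of `l`, once `next l` is removed,
-- is the edge that ends at `l`.
near-vertex : ∀ l m → Near l m → m ≢ next l → On (next (next (next (next l)))) m
near-vertex = from-yes (all? λ l → all? λ m →
  near? l m →-dec ¬? (m ≟ next l) →-dec on? (next (next (next (next l)))) m)

-- Bracketed with a final `0` so as to agree definitionally with `sum` of a vector of five entries.
sum₅ : (Fin 5 → ℕ) → ℕ
sum₅ f = f 0F + (f 1F + (f 2F + (f 3F + (f 4F + 0))))

orbit-sum : (Fin 5 → ℕ) → Fin 5 → ℕ
orbit-sum f i =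
  f i + (f (next i) + (f (next (next i)) + (f (next (next (next i))) + (f (next (next (next (next i)))) + 0))))

sum₅-orbit : ∀ f i → sum₅ f ≡ orbit-sum f i
sum₅-orbit f = λ where
    0F → refl
    1F → rot₁ (f 0F) (f 1F) (f 2F) (f 3F) (f 4F)
    2F → rot₂ (f 0F) (f 1F) (f 2F) (f 3F) (f 4F)
    3F → rot₃ (f 0F) (f 1F) (f 2F) (f 3F) (f 4F)
    4F → rot₄ (f 0F) (f 1F) (f 2F) (f 3F) (f 4F)
  where
  rot₁ : ∀ a b c d e → a + (b + (c + (d + (e + 0)))) ≡ b + (c + (d + (e + (a + 0))))
  rot₁ = solve-∀
  rot₂ : ∀ a b c d e → a + (b + (c + (d + (e + 0)))) ≡ c + (d + (e + (a + (b + 0))))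
  rot₂ = solve-∀
  rot₃ : ∀ a b c d e → a + (b + (c + (d + (e + 0)))) ≡ d + (e + (a + (b + (c + 0))))
  rot₃ = solve-∀
  rot₄ : ∀ a b c d e → a + (b + (c + (d + (e + 0)))) ≡ e + (a + (b + (c + (d + 0))))
  rot₄ = solve-∀

-- Rotational symmetry is used up here once: column sizes can be bounded at positions relative to
-- any `i`, without a case split on `i`.
orbit-bound : ∀ f i {a b c d e} →
  f i ≤ a → f (next i) ≤ b → f (next (next i)) ≤ c → f (next (next (next i))) ≤ d →
  f (next (next (next (next i)))) ≤ e → sum₅ f ≤ a + (b + (c + (d + (e + 0))))
orbit-bound f i p q r s t =
  ≤-trans (≤-reflexive (sum₅-orbit f i))
    (+-mono-≤ p (+-mono-≤ q (+-mono-≤ r (+-mono-≤ s (+-mono-≤ t ≤-refl)))))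

-- The expansion of a graph along the pentagon

module Expansion (B : Graph n) where

  -- (i , zero) is the vertex vᵢ, and (i , suc x) is the vertex x of the i-th copy of B.
  Vertex : Set
  Vertex = Fin 5 × Fin (suc n)

  E : Vertex → Vertex → Set
  E (i , zero)  (j , zero)  = Absurd
  E (i , zero)  (j , suc y) = On i j
  E (i , suc x) (j , zero)  = On j i
  E (i , suc x) (j , suc y) = Cyc i j ⊎ (i ≡ j × Adj B x y)

  E-sym : ∀ u v → E u v → E v u
  E-sym (i , zero)  (j , suc y) e = e
  E-sym (i , suc x) (j , zero)  e = e
  E-sym (i , suc x) (j , suc y) (inj₁ c) = inj₁ (cyc-sym c)
  E-sym (i , suc x) (j , suc y) (inj₂ (p , a)) = inj₂ (≡-sym p , sym B a)

  E-irrefl : ∀ u → ¬ E u u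
  E-irrefl (i , suc x) (inj₁ c) = cyc-irrefl i c
  E-irrefl (i , suc x) (inj₂ (_ , a)) = irrefl B a

  split : Fin (5 * suc n) → Vertex
  split = remQuot (suc n)

  Φ : Graph (5 * suc n)
  Φ .Adj u v = E (split u) (split v)
  Φ .Graph.sym {u} {v} = E-sym (split u) (split v)
  Φ .Graph.irrefl {u} = E-irrefl (split u)

  adj⁺ : ∀ {i x j y} → E (i , x) (j , y) → Adj Φ (combine i x) (combine j y)
  adj⁺ {i} {x} {j} {y} = subst₂ E (≡-sym (remQuot-combine i x)) (≡-sym (remQuot-combine j y))

  adj⁻ : ∀ {i x j y} → Adj Φ (combine i x) (combine j y) → E (i , x) (j , y)
  adj⁻ {i} {x} {j} {y} = subst₂ E (remQuot-combine i x) (remQuot-combine j y)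

  combine-inj : ∀ {i x j y} → combine i x ≡ combine j y → (i , x) ≡ (j , y)
  combine-inj {i} {x} {j} {y} e =
    trans (≡-sym (remQuot-combine i x)) (trans (cong split e) (remQuot-combine j y))

  -- Vertex sets of the expansion as five columns

  Columns : Set
  Columns = Vec (Subset (suc n)) 5

  -- Position zero of column `i` stands for vᵢ, so the tail is the part of the set inside the `i`-th
  -- copy of `B`.
  copy : Columns → Fin 5 → Subset n
  copy ps i = tail (lookup ps i)

  module _ (ps : Columns) where

    Clique′ : Set
    Clique′ = ∀ {i x j y} → x ∈ lookup ps i → y ∈ lookup ps j → (i , x) ≢ (j , y) → E (i , x) (j , y)

    Stable′ : Set
    Stable′ = ∀ {i x j y} → x ∈ lookup ps i → y ∈ lookup ps j → ¬ E (i , x) (j , y)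

    clique⁻ : IsClique Φ (concat ps) → Clique′
    clique⁻ clq p q u≢v = adj⁻ (clq (∈-concat⁺ ps p) (∈-concat⁺ ps q) (u≢v ∘ combine-inj))

    stable⁻ : IsStable Φ (concat ps) → Stable′
    stable⁻ stb p q e = stb (∈-concat⁺ ps p) (∈-concat⁺ ps q) (adj⁺ e)

    clique⁺ : Clique′ → IsClique Φ (concat ps)
    clique⁺ clq {u} {v} p q u≢v with combine-surjective {5} {suc n} u | combine-surjective {5} {suc n} v
    ... | i , x , refl | j , y , refl =
      adj⁺ {i} {x} {j} {y} (clq (∈-concat⁻ ps p) (∈-concat⁻ ps q) (λ where refl → u≢v refl))

    stable⁺ : Stable′ → IsStable Φ (concat ps)
    stable⁺ stb {u} {v} p q e with combine-surjective {5} {suc n} u | combine-surjective {5} {suc n} v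
    ... | i , x , refl | j , y , refl =
      stb (∈-concat⁻ ps p) (∈-concat⁻ ps q) (adj⁻ {i} {x} {j} {y} e)

    cliqueSaturated⁻ : CliqueSaturated Φ (concat ps) → ∀ j y →
      (∀ i x → x ∈ lookup ps i → (i , x) ≢ (j , y) → E (i , x) (j , y)) → y ∈ lookup ps j
    cliqueSaturated⁻ sat j y h = ∈-concat⁻ ps (sat (combine j y) h′)
      where
      h′ : ∀ u → u ∈ concat ps → u ≢ combine j y → Adj Φ u (combine j y)
      h′ u p u≢ with combine-surjective {5} {suc n} u
      ... | i , x , refl = adj⁺ (h i x (∈-concat⁻ ps p) (λ where refl → u≢ refl))

    stableSaturated⁻ : StableSaturated Φ (concat ps) → ∀ j y →
      (∀ i x → x ∈ lookup ps i → ¬ E (i , x) (j , y)) → y ∈ lookup ps j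
    stableSaturated⁻ sat j y h = ∈-concat⁻ ps (sat (combine j y) h′)
      where
      h′ : ∀ u → u ∈ concat ps → ¬ Adj Φ u (combine j y)
      h′ u p e with combine-surjective {5} {suc n} u
      ... | i , x , refl = h i x (∈-concat⁻ ps p) (adj⁻ e)

    size : Fin 5 → ℕ
    size i = ∣ lookup ps i ∣

  ∣columns∣ : ∀ ps → ∣ concat ps ∣ ≡ sum₅ (size ps)
  ∣columns∣ ps@(_ ∷ _ ∷ _ ∷ _ ∷ _ ∷ []) = ∣concat∣ ps

  copy-clique : ∀ ps → Clique′ ps → ∀ j → IsClique B (copy ps j)
  copy-clique ps clq j p q u≢v with clq {i = j} {j = j} (∈-tail⁻ p) (∈-tail⁻ q) (λ where refl → u≢v refl)
  ... | inj₁ c = ⊥-elim (cyc-irrefl j c)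
  ... | inj₂ (_ , a) = a

  copy-stable : ∀ ps → Stable′ ps → ∀ j → IsStable B (copy ps j)
  copy-stable ps stb j p q a = stb {i = j} {j = j} (∈-tail⁻ p) (∈-tail⁻ q) (inj₂ (refl , a))

  -- Maximal cliques, maximal stable sets and the CIS property

  AtEdge : Columns → Fin 5 → Set
  AtEdge ps i = (∀ {l} → zero ∈ lookup ps l → l ≡ i) × (∀ {l x} → suc x ∈ lookup ps l → On i l)

  clique-near : ∀ ps → Clique′ ps → ∀ {l x m y} → suc x ∈ lookup ps l → suc y ∈ lookup ps m → Near l m
  clique-near ps clq {l} {x} {m} {y} p q with l ≟ m
  ... | yes e = inj₁ e
  ... | no ¬e with clq p q (¬e ∘ cong proj₁)
  ...   | inj₁ c = inj₂ c
  ...   | inj₂ (e , _) = inj₁ e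

  -- If some vᵢ lies in the clique, its adjacencies confine all other members to edge `i`. Otherwise
  -- take an occupied copy `l`: all occupied copies are near it, and the edge is the one leaving `l`
  -- or the one entering `l`, according to whether copy `next l` is occupied.
  clique⇒atEdge : ∀ ps → Clique′ ps → ∃ (AtEdge ps)
  clique⇒atEdge ps clq with any? (λ l → zero ∈? lookup ps l)
  ... | yes (i , p) = i , same , λ q → clq p q (λ ())
    where
    same : ∀ {l} → zero ∈ lookup ps l → l ≡ i
    same {l} q with l ≟ i
    ... | yes e = e
    ... | no ¬e = ⊥-elim (clq q p (¬e ∘ cong proj₁))
  ... | no no-v with any? (λ l → nonempty? (copy ps l))
  -- The clique is empty, so any edge would do.
  ...   | no none = 0F , (λ q → contradiction (_ , q) no-v) , λ q → contradiction (_ , _ , ∈-tail⁺ q) none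
  ...   | yes (l , x , p) with nonempty? (copy ps (next l))
  ...     | yes (y , q) = l , (λ r → contradiction (_ , r) no-v) , λ r →
              near-edge l _ (clique-near ps clq (∈-tail⁻ p) r) (clique-near ps clq (∈-tail⁻ q) r)
  ...     | no none = next (next (next (next l))) , (λ r → contradiction (_ , r) no-v) , λ r →
              near-vertex l _ (clique-near ps clq (∈-tail⁻ p) r) (λ where refl → none (_ , ∈-tail⁺ r))

  -- Every other member lies in a copy joined to vᵢ, so vᵢ could be added.
  atEdge-apex : ∀ ps → CliqueSaturated Φ (concat ps) → ∀ {i} → AtEdge ps i → zero ∈ lookup ps i
  atEdge-apex ps sat {i} (v≡ , on) = cliqueSaturated⁻ ps sat i zero λ where
    l zero    p u≢ → u≢ (cong (_, zero) (v≡ p))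
    l (suc x) p u≢ → on p

  -- The members outside copy `j` are at most vᵢ and vertices of the other copy on the edge, all
  -- joined to the whole of copy `j`. A vertex that extends the clique inside the copy therefore
  -- extends it in `Φ`.
  copy-cliqueSaturated : ∀ ps → CliqueSaturated Φ (concat ps) → ∀ {i j} → AtEdge ps i → On i j →
    CliqueSaturated B (copy ps j)
  copy-cliqueSaturated ps sat {i} {j} (v≡ , on) ij y h = ∈-tail⁺ (cliqueSaturated⁻ ps sat j (suc y) adj)
    where
    adj : ∀ l x → x ∈ lookup ps l → (l , x) ≢ (j , suc y) → E (l , x) (j , suc y)
    adj l zero p _ = subst (λ l → On l j) (≡-sym (v≡ p)) ij
    adj l (suc x) p u≢ with on⇒near i (on p) ij
    ... | inj₁ refl = inj₂ (refl , h x (∈-tail⁺ p) (λ where refl → u≢ refl))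
    ... | inj₂ c = inj₁ c

  -- All vertices of one copy have the same neighbours outside it, so one member of the copy excludes them.
  copy-stableSaturated : ∀ ps → Stable′ ps → StableSaturated Φ (concat ps) → ∀ {j} →
    Nonempty (copy ps j) → StableSaturated B (copy ps j)
  copy-stableSaturated ps stb sat {j} (x₀ , p₀) y h = ∈-tail⁺ (stableSaturated⁻ ps sat j (suc y) λ where
    l zero    p e              → stb p (∈-tail⁻ p₀) e
    l (suc x) p (inj₁ c)          → stb p (∈-tail⁻ p₀) (inj₁ c)
    l (suc x) p (inj₂ (refl , a)) → h x (∈-tail⁺ p) a)

  -- The neighbours of vᵢ are exactly copies `i` and `next i`; a saturated set that avoids both
  -- would contain vᵢ.
  meets-edge : ∀ ps → StableSaturated Φ (concat ps) → ∀ i → zero ∉ lookup ps i →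
    ∃ λ j → On i j × Nonempty (copy ps j)
  meets-edge ps sat i v∉ with nonempty? (copy ps i) | nonempty? (copy ps (next i))
  ... | yes ne | _      = i , inj₁ refl , ne
  ... | no _   | yes ne = next i , inj₂ refl , ne
  ... | no e   | no e′  = contradiction
    (stableSaturated⁻ ps sat i zero λ where
      l (suc x) p (inj₁ refl) → e (x , ∈-tail⁺ p)
      l (suc x) p (inj₂ refl) → e′ (x , ∈-tail⁺ p))
    v∉

  Φ-CIS : IsCIS B → IsCIS Φ
  Φ-CIS cis C S maxC maxS with group 5 (suc n) C | group 5 (suc n) S
  ... | ps , refl | qs , refl = result
    where
    clq : Clique′ ps
    clq = clique⁻ ps (proj₁ maxC)
    satC : CliqueSaturated Φ (concat ps)
    satC = maximal⇒cliqueSaturated Φ maxC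
    stb : Stable′ qs
    stb = stable⁻ qs (proj₁ maxS)
    satS : StableSaturated Φ (concat qs)
    satS = maximal⇒stableSaturated Φ maxS
    result : Σ (Fin (5 * suc n)) (λ v → v ∈ concat ps × v ∈ concat qs)
    result with clique⇒atEdge ps clq
    ... | i , at with zero ∈? lookup qs i
    ...   | yes v∈S = combine i zero , ∈-concat⁺ ps (atEdge-apex ps satC at) , ∈-concat⁺ qs v∈S
    ...   | no v∉S with meets-edge qs satS i v∉S
    ...     | j , ij , ne with cis (copy ps j) (copy qs j)
                (cliqueSaturated⇒maximal B (copy-clique ps clq j) (copy-cliqueSaturated ps satC at ij))
                (stableSaturated⇒maximal B (copy-stable qs stb j) (copy-stableSaturated qs stb satS ne))
    ...       | x , x∈C , x∈S =
                combine j (suc x) , ∈-concat⁺ ps (∈-tail⁻ x∈C) , ∈-concat⁺ qs (∈-tail⁻ x∈S)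

  -- Upper bounds for clique and stable set sizes

  size-bound : ∀ ps i {b} → ∣ copy ps i ∣ ≤ b → size ps i ≤ 1 + b
  size-bound ps i h = ≤-trans (∣p∣≤1+∣tail∣ (lookup ps i)) (s≤s h)

  size-bound′ : ∀ ps i {b} → zero ∉ lookup ps i → ∣ copy ps i ∣ ≤ b → size ps i ≤ b
  size-bound′ ps i v∉ h = ≤-trans (∣p∣≤∣tail∣ (lookup ps i) v∉) h

  -- Along its edge the clique has vᵢ and one clique of `B` in each of two copies; the other three
  -- columns are empty.
  Φ-omega-≤ : ∀ {w} → (∀ K → IsClique B K → ∣ K ∣ ≤ w) → ∀ K → IsClique Φ K → ∣ K ∣ ≤ 1 + (w + w)
  Φ-omega-≤ {w} bound K clqK with group 5 (suc n) K
  ... | ps , refl with clique⇒atEdge ps (clique⁻ ps clqK)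
  ...   | i , v≡ , on = begin
    ∣ concat ps ∣                     ≡⟨ ∣columns∣ ps ⟩
    sum₅ (size ps)                    ≤⟨ orbit-bound (size ps) i
                                           (size-bound ps i (copy≤ i))
                                           (size-bound′ ps (next i) (v∉ (off₁ i)) (copy≤ (next i)))
                                           (none (next (next i)) (off₂ i))
                                           (none (next (next (next i))) (off₃ i))
                                           (none (next (next (next (next i)))) (off₄ i)) ⟩
    suc w + (w + (0 + (0 + (0 + 0)))) ≡⟨ cong (suc w +_) (+-identityʳ w) ⟩
    1 + (w + w)                       ∎
    where
    open ≤-Reasoning
    copy≤ : ∀ j → ∣ copy ps j ∣ ≤ w
    copy≤ j = bound (copy ps j) (copy-clique ps (clique⁻ ps clqK) j)
    v∉ : ∀ {j} → j ≢ i → zero ∉ lookup ps j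
    v∉ j≢i p = j≢i (v≡ p)
    none : ∀ j → ¬ On i j → size ps j ≤ 0
    none j ¬on = size-bound′ ps j (v∉ (¬on ∘ inj₁))
      (Empty⇒∣p∣≤0 (copy ps j) (λ (x , p) → ¬on (on (∈-tail⁻ p))))
    off₁ : ∀ i → next i ≢ i
    off₁ = from-yes (all? λ i → ¬? (next i ≟ i))
    off₂ : ∀ i → ¬ On i (next (next i))
    off₂ = from-yes (all? λ i → ¬? (on? i (next (next i))))
    off₃ : ∀ i → ¬ On i (next (next (next i)))
    off₃ = from-yes (all? λ i → ¬? (on? i (next (next (next i)))))
    off₄ : ∀ i → ¬ On i (next (next (next (next i))))
    off₄ = from-yes (all? λ i → ¬? (on? i (next (next (next (next i))))))

  -- At most two copies are occupied, as C₅ has no three pairwise non-adjacent vertices. Two, one or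
  -- no occupied copies leave room for at most one, three or five of the vᵢ, giving 2a + 1, a + 3 or
  -- 5. The hypothesis `2 ≤ a` makes the first value the largest; the five vᵢ do form a stable set.
  Φ-alpha-≤ : ∀ {a} → 2 ≤ a → (∀ S → IsStable B S → ∣ S ∣ ≤ a) → ∀ S → IsStable Φ S → ∣ S ∣ ≤ 1 + (a + a)
  Φ-alpha-≤ {a} 2≤a bound S stbS with group 5 (suc n) S
  ... | ps , refl = ≤-trans (≤-reflexive (∣columns∣ ps)) total
    where
    stb : Stable′ ps
    stb = stable⁻ ps stbS
    copy≤ : ∀ j → ∣ copy ps j ∣ ≤ a
    copy≤ j = bound (copy ps j) (copy-stable ps stb j)
    v∉ : ∀ {i j} → Nonempty (copy ps j) → On i j → zero ∉ lookup ps i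
    v∉ (x , p) ij q = stb q (∈-tail⁻ p) ij
    empty : ∀ {l m} → Nonempty (copy ps l) → Cyc l m → Empty (copy ps m)
    empty (x , p) lm (y , q) = stb (∈-tail⁻ p) (∈-tail⁻ q) (inj₁ lm)
    ≤full : ∀ j → Nonempty (copy ps j) → size ps j ≤ a
    ≤full j ne = size-bound′ ps j (v∉ ne (inj₁ refl)) (copy≤ j)
    ≤one : ∀ j → Empty (copy ps j) → size ps j ≤ 1
    ≤one j e = size-bound ps j (Empty⇒∣p∣≤0 (copy ps j) e)
    -- An occupied copy empties the column before it, whose new vertex is joined to that copy as
    -- well. The column after it may keep its new vertex, so there only `≤one` is available.
    ≤none : ∀ j → Nonempty (copy ps (next j)) → size ps j ≤ 0
    ≤none j ne = size-bound′ ps j (v∉ ne (inj₂ refl)) (Empty⇒∣p∣≤0 (copy ps j) (empty ne (inj₂ refl)))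
    4≤a+a : 4 ≤ a + a
    4≤a+a = +-mono-≤ 2≤a 2≤a
    sum₁ : ∀ a → a + (0 + (a + (1 + (0 + 0)))) ≡ 1 + (a + a)
    sum₁ = solve-∀
    sum₂ : ∀ a → a + (1 + (0 + (a + (0 + 0)))) ≡ 1 + (a + a)
    sum₂ = solve-∀
    sum₃ : ∀ a → a + 3 ≡ 1 + (a + 2)
    sum₃ = solve-∀
    total : sum₅ (size ps) ≤ 1 + (a + a)
    total with any? (λ l → nonempty? (copy ps l))
    ... | no none = ≤-trans
            (orbit-bound (size ps) 0F (one 0F) (one 1F) (one 2F) (one 3F) (one 4F)) (s≤s 4≤a+a)
      where
      one : ∀ j → size ps j ≤ 1
      one j = ≤one j (λ ne → none (j , ne))
    -- Copies `i₁` and `i₄` are adjacent to the occupied copy `i`, so a second occupied copy is `i₂`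
    -- or `i₃`, and not both, as these are adjacent.
    ... | yes (i , ne) = rest (nonempty? (copy ps i₂)) (nonempty? (copy ps i₃))
      where
      i₁ i₂ i₃ i₄ : Fin 5
      i₁ = next i
      i₂ = next i₁
      i₃ = next i₂
      i₄ = next i₃
      last : size ps i₄ ≤ 0
      last = ≤none i₄ (subst (λ j → Nonempty (copy ps j)) (≡-sym (next⁵ i)) ne)
      first : size ps i₁ ≤ 1
      first = ≤one i₁ (empty ne (inj₁ refl))
      rest : Dec (Nonempty (copy ps i₂)) → Dec (Nonempty (copy ps i₃)) → sum₅ (size ps) ≤ 1 + (a + a)
      rest (yes ne₂) _ = ≤-trans
        (orbit-bound (size ps) i (≤full i ne) (≤none i₁ ne₂) (≤full i₂ ne₂)
          (≤one i₃ (empty ne₂ (inj₁ refl))) last)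
        (≤-reflexive (sum₁ a))
      rest (no _) (yes ne₃) = ≤-trans
        (orbit-bound (size ps) i (≤full i ne) first (≤none i₂ ne₃) (≤full i₃ ne₃) last)
        (≤-reflexive (sum₂ a))
      rest (no e₂) (no e₃) = ≤-trans
        (orbit-bound (size ps) i (≤full i ne) first (≤one i₂ e₂) (≤one i₃ e₃) last)
        (≤-trans (≤-reflexive (sum₃ a)) (s≤s (+-monoʳ-≤ a 2≤a)))

  -- Stable sets and cliques attaining the bounds

  none : Subset (suc n)
  none = outside ∷ ⊥

  only : Subset n → Subset (suc n)
  only S = outside ∷ S

  apex : Subset (suc n)
  apex = inside ∷ ⊥

  none-empty : ∀ {x} → x ∉ none
  none-empty (there p) = ∉⊥ p

  -- Copies 0 and 2 are non-adjacent, and v₃, joined only to copies 3 and 4, is the one new vertex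
  -- that sees neither.
  bigStable : Subset n → Columns
  bigStable S = only S ∷ none ∷ only S ∷ apex ∷ none ∷ []

  bigClique : Subset n → Columns
  bigClique K = (inside ∷ K) ∷ only K ∷ none ∷ none ∷ none ∷ []

  -- Listing the members as constructors turns the adjacency checks into pattern matching on pairs.
  data InBigStable (S : Subset n) : Vertex → Set where
    at₀ : ∀ {x} → x ∈ S → InBigStable S (0F , suc x)
    at₂ : ∀ {x} → x ∈ S → InBigStable S (2F , suc x)
    v₃  : InBigStable S (3F , zero)

  data InBigClique (K : Subset n) : Vertex → Set where
    v₀  : InBigClique K (0F , zero)
    at₀ : ∀ {x} → x ∈ K → InBigClique K (0F , suc x)
    at₁ : ∀ {x} → x ∈ K → InBigClique K (1F , suc x)

  inBigStable : ∀ S {i x} → x ∈ lookup (bigStable S) i → InBigStable S (i , x)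
  inBigStable S {0F} (there p) = at₀ p
  inBigStable S {1F} p         = contradiction p none-empty
  inBigStable S {2F} (there p) = at₂ p
  inBigStable S {3F} here      = v₃
  inBigStable S {3F} (there p) = contradiction p ∉⊥
  inBigStable S {4F} p         = contradiction p none-empty

  inBigClique : ∀ K {i x} → x ∈ lookup (bigClique K) i → InBigClique K (i , x)
  inBigClique K {0F} here      = v₀
  inBigClique K {0F} (there p) = at₀ p
  inBigClique K {1F} (there p) = at₁ p
  inBigClique K {2F} p         = contradiction p none-empty
  inBigClique K {3F} p         = contradiction p none-empty
  inBigClique K {4F} p         = contradiction p none-empty

  bigStable-stable : ∀ {S} → IsStable B S → Stable′ (bigStable S)
  bigStable-stable {S} stb p q = separate (inBigStable S p) (inBigStable S q)
    where
    separate : ∀ {u v} → InBigStable S u → InBigStable S v → ¬ E u v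
    separate (at₀ p) (at₀ q) (inj₂ (_ , a)) = stb p q a
    separate (at₂ p) (at₂ q) (inj₂ (_ , a)) = stb p q a
    separate (at₀ p) (at₀ q) (inj₁ c) = cyc-irrefl 0F c
    separate (at₂ p) (at₂ q) (inj₁ c) = cyc-irrefl 2F c
    separate (at₀ p) (at₂ q) (inj₁ (inj₁ ()))
    separate (at₀ p) (at₂ q) (inj₁ (inj₂ ()))
    separate (at₂ p) (at₀ q) (inj₁ (inj₁ ()))
    separate (at₂ p) (at₀ q) (inj₁ (inj₂ ()))
    separate (at₀ p) v₃ (inj₁ ())
    separate (at₀ p) v₃ (inj₂ ())
    separate (at₂ p) v₃ (inj₁ ())
    separate (at₂ p) v₃ (inj₂ ())
    separate v₃ (at₀ q) (inj₁ ())
    separate v₃ (at₀ q) (inj₂ ())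
    separate v₃ (at₂ q) (inj₁ ())
    separate v₃ (at₂ q) (inj₂ ())

  bigClique-clique : ∀ {K} → IsClique B K → Clique′ (bigClique K)
  bigClique-clique {K} clq p q = join (inBigClique K p) (inBigClique K q)
    where
    join : ∀ {u v} → InBigClique K u → InBigClique K v → u ≢ v → E u v
    join v₀      v₀      u≢v = contradiction refl u≢v
    join v₀      (at₀ q) u≢v = inj₁ refl
    join v₀      (at₁ q) u≢v = inj₂ refl
    join (at₀ p) v₀      u≢v = inj₁ refl
    join (at₁ p) v₀      u≢v = inj₂ refl
    join (at₀ p) (at₁ q) u≢v = inj₁ (inj₁ refl)
    join (at₁ p) (at₀ q) u≢v = inj₁ (inj₂ refl)
    join (at₀ p) (at₀ q) u≢v = inj₂ (refl , clq p q (λ where refl → u≢v refl))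
    join (at₁ p) (at₁ q) u≢v = inj₂ (refl , clq p q (λ where refl → u≢v refl))

  ∣bigStable∣ : ∀ S → ∣ concat (bigStable S) ∣ ≡ 1 + (∣ S ∣ + ∣ S ∣)
  ∣bigStable∣ S rewrite ∣concat∣ (bigStable S) | ∣⊥∣≡0 n = arith ∣ S ∣
    where
    arith : ∀ a → a + (a + 1) ≡ 1 + (a + a)
    arith = solve-∀

  ∣bigClique∣ : ∀ K → ∣ concat (bigClique K) ∣ ≡ 1 + (∣ K ∣ + ∣ K ∣)
  ∣bigClique∣ K rewrite ∣concat∣ (bigClique K) | ∣⊥∣≡0 n | +-identityʳ ∣ K ∣ = refl

  Φ-alpha : ∀ {a} → 2 ≤ a → IsAlpha B a → IsAlpha Φ (1 + (a + a))
  Φ-alpha 2≤a ((S , stb , refl) , bound) =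
    (concat (bigStable S) , stable⁺ (bigStable S) (bigStable-stable stb) , ∣bigStable∣ S) ,
    Φ-alpha-≤ 2≤a bound

  Φ-omega : ∀ {w} → IsOmega B w → IsOmega Φ (1 + (w + w))
  Φ-omega ((K , clq , refl) , bound) =
    (concat (bigClique K) , clique⁺ (bigClique K) (bigClique-clique clq) , ∣bigClique∣ K) ,
    Φ-omega-≤ bound

open Expansion using (Φ; Φ-CIS; Φ-alpha; Φ-omega)

-- Iterating the expansion

-- The iteration must start with α at least 2 for `Φ-alpha` to apply; two isolated vertices achieve
-- this.
edgeless₂ : Graph 2
edgeless₂ .Adj _ _ = Absurd
edgeless₂ .Graph.sym ()
edgeless₂ .Graph.irrefl ()

-- Without edges a maximal stable set contains every vertex, so any member of `C` serves; `C` has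
-- one because the empty clique extends by `0F`.
edgeless₂-CIS : IsCIS edgeless₂
edgeless₂-CIS C S maxC maxS with nonempty? C
... | yes (x , x∈C) = x , x∈C , maximal⇒stableSaturated edgeless₂ maxS x (λ _ _ ())
... | no empty = contradiction
  (0F , maximal⇒cliqueSaturated edgeless₂ maxC 0F (λ u u∈C → contradiction (u , u∈C) empty)) empty

edgeless₂-alpha : IsAlpha edgeless₂ 2
edgeless₂-alpha = (⊤ , (λ _ _ ()) , refl) , λ S _ → ∣p∣≤n S

edgeless₂-omega : IsOmega edgeless₂ 1
edgeless₂-omega = (⁅ 0F ⁆ , single , refl) , bound
  where
  single : IsClique edgeless₂ ⁅ 0F ⁆
  single p q u≢v = u≢v (trans (x∈⁅y⁆⇒x≡y 0F p) (≡-sym (x∈⁅y⁆⇒x≡y 0F q)))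
  bound : ∀ K → IsClique edgeless₂ K → ∣ K ∣ ≤ 1
  bound (true  ∷ true  ∷ []) clq = ⊥-elim (clq {0F} {1F} here (there here) (λ ()))
  bound (true  ∷ false ∷ []) clq = s≤s z≤n
  bound (false ∷ true  ∷ []) clq = s≤s z≤n
  bound (false ∷ false ∷ []) clq = z≤n

-- The map sending x to 2x + 1 doubles x + 1, so `suc α` and `suc ω` have exact closed forms,
-- starting from 3 and 2. For the order, a lower bound that drops the five new vertices of each
-- round is enough.
record Iterate (t : ℕ) : Set₁ where
  field
    order α ω : ℕ
    graph     : Graph order
    cis       : IsCIS graph
    isAlpha   : IsAlpha graph α
    isOmega   : IsOmega graph ω
    2≤α       : 2 ≤ α
    order-≥   : 2 * 5 ^ t ≤ order
    α-eq      : suc α ≡ 3 * 2 ^ t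
    ω-eq      : suc ω ≡ 2 * 2 ^ t

double-suc : ∀ x c p → suc x ≡ c * p → 2 + (x + x) ≡ c * (2 * p)
double-suc x c p e = trans (lhs x) (trans (cong (2 *_) e) (rhs c p))
  where
  lhs : ∀ x → 2 + (x + x) ≡ 2 * suc x
  lhs = solve-∀
  rhs : ∀ c p → 2 * (c * p) ≡ c * (2 * p)
  rhs = solve-∀

iterate : ∀ t → Iterate t
iterate zero = record
  { graph = edgeless₂ ; cis = edgeless₂-CIS ; isAlpha = edgeless₂-alpha ; isOmega = edgeless₂-omega
  ; 2≤α = ≤-refl ; order-≥ = ≤-refl ; α-eq = refl ; ω-eq = refl }
iterate (suc t) = record
  { graph = Φ graph ; cis = Φ-CIS graph cis
  ; isAlpha = Φ-alpha graph 2≤α isAlpha ; isOmega = Φ-omega graph isOmega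
  ; 2≤α = ≤-trans 2≤α (m≤n+m _ _)
  ; order-≥ = grow
  ; α-eq = double-suc α 3 (2 ^ t) α-eq
  ; ω-eq = double-suc ω 2 (2 ^ t) ω-eq }
  where
  open Iterate (iterate t)
  swap : ∀ p → 2 * (5 * p) ≡ 5 * (2 * p)
  swap = solve-∀
  grow : 2 * 5 ^ suc t ≤ 5 * suc order
  grow = ≤-trans (≤-reflexive (swap (5 ^ t))) (*-monoʳ-≤ 5 (≤-trans order-≥ (n≤1+n order)))

-- Bernoulli's inequality (1 + 1/4)^t ≥ 1 + t/4, cleared of denominators.
bernoulli : ∀ t → 4 ^ t * (4 + t) ≤ 4 * 5 ^ t
bernoulli zero    = ≤-refl
bernoulli (suc t) = begin
  4 * 4 ^ t * (5 + t)         ≤⟨ m≤m+n _ (4 ^ t * t) ⟩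
  4 * 4 ^ t * (5 + t) + 4 ^ t * t ≡⟨ lhs (4 ^ t) t ⟩
  5 * (4 ^ t * (4 + t))       ≤⟨ *-monoʳ-≤ 5 (bernoulli t) ⟩
  5 * (4 * 5 ^ t)             ≡⟨ rhs (5 ^ t) ⟩
  4 * 5 ^ suc t               ∎
  where
  open ≤-Reasoning
  lhs : ∀ p t → 4 * p * (5 + t) + p * t ≡ 5 * (p * (4 + t))
  lhs = solve-∀
  rhs : ∀ p → 5 * (4 * p) ≡ 4 * (5 * p)
  rhs = solve-∀

2^t*2^t : ∀ t → 2 ^ t * 2 ^ t ≡ 4 ^ t
2^t*2^t zero    = refl
2^t*2^t (suc t) = trans (arith (2 ^ t)) (cong (4 *_) (2^t*2^t t))
  where
  arith : ∀ p → 2 * p * (2 * p) ≡ 4 * (p * p)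
  arith = solve-∀

-- The exponent t = 12k is chosen so that twice the left side, 12k times the square of 2^t, becomes
-- exactly t times 4^t, which `bernoulli` bounds by 4 times 5^t.
powers-gap : ∀ k → k * ((3 * 2 ^ (12 * k)) * (2 * 2 ^ (12 * k))) ≤ 2 * 5 ^ (12 * k)
powers-gap k = *-cancelˡ-≤ 2 (begin
  2 * (k * ((3 * 2 ^ t) * (2 * 2 ^ t))) ≡⟨ collect k (2 ^ t) ⟩
  2 ^ t * 2 ^ t * t                     ≡⟨ cong (_* t) (2^t*2^t t) ⟩
  4 ^ t * t                             ≤⟨ *-monoʳ-≤ (4 ^ t) (m≤n+m t 4) ⟩
  4 ^ t * (4 + t)                       ≤⟨ bernoulli t ⟩
  4 * 5 ^ t                             ≡⟨ *-assoc 2 2 (5 ^ t) ⟩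
  2 * (2 * 5 ^ t)                       ∎)
  where
  open ≤-Reasoning
  t : ℕ
  t = 12 * k
  collect : ∀ k p → 2 * (k * ((3 * p) * (2 * p))) ≡ p * p * (12 * k)
  collect = solve-∀

theorem15 : (k : ℕ) → k > 0 →
    Σ ℕ (λ n → Σ (Graph n) (λ G → IsCIS G ×
    Σ ℕ (λ a → Σ ℕ (λ w → IsAlpha G a × IsOmega G w × n > k * a * w))))
theorem15 k k>0 = order , graph , cis , α , ω , isAlpha , isOmega , (begin-strict
  k * α * ω                         ≡⟨ *-assoc k α ω ⟩
  -- Passing to the successors gives both the strict inequality, preserved since k is positive, and
  -- the factors with closed forms.
  k * (α * ω)                       <⟨ *-monoʳ-< k {{>-nonZero k>0}} (*-mono-< (n<1+n α) (n<1+n ω)) ⟩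
  k * (suc α * suc ω)               ≡⟨ cong (k *_) (cong₂ _*_ α-eq ω-eq) ⟩
  k * ((3 * 2 ^ t) * (2 * 2 ^ t))   ≤⟨ powers-gap k ⟩
  2 * 5 ^ t                         ≤⟨ order-≥ ⟩
  order                             ∎)
  where
  open ≤-Reasoning
  t : ℕ
  t = 12 * k
  open Iterate (iterate t)
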